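{- For every integer $n\ge 0$, the number of ways to tile an $n$-board using half-squares and $(\frac12,\frac12)$-fences equals $F_{n+1}^2$.
   Context: The Fibonacci numbers are $F_0=0$, $F_1=1$, $F_n=F_{n-1}+F_{n-2}$ for $n\ge2$. An $n$-board is a $1\times n$ array of $n$ unit square cells in a row (horizontal extent $[0,n]$). A half-square is a tile of width $\frac12$ and height $1$, covering a horizontal interval $[x,x+\frac12]$. A $(\frac12,\frac12)$-fence is a single tile composed of two pieces (posts), each of width $\frac12$ and height $1$, separated by a gap of width $\frac12$; it covers $[x,x+\frac12]\cup[x+1,x+\frac32]$ for some $x$. Tiles are not rotated. Tiles need not be aligned with the cell boundaries, and the gap of a fence must be covered by other tiles. A tiling covers the board exactly, with no overlaps (of interiors), no uncovered region and nothing protruding from the board. There is exactly one (empty) tiling of the $0$-board. -}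

module Defs where

open import Algebra.Bundles using (CommutativeRing)
open import Algebra.Core using (Op₁; Op₂)
import Algebra.Definitions.RawMonoid as RawMonoidDefs
open import Algebra.Structures using (IsCommutativeRing)
open import Data.List.Base using (List; []; _∷_)
open import Data.List.Relation.Binary.Permutation.Propositional using (↭-setoid)
open import Data.List.Relation.Unary.All using (All)
open import Data.List.Relation.Unary.AllPairs using (AllPairs)
open import Data.List.Relation.Unary.Any using (Any)
open import Data.Nat.Base as ℕ using (ℕ; zero; suc)
open import Data.Product.Base using (_×_)
open import Data.Rational.Base as ℚ using (ℚ; 0ℚ; 1ℚ)
import Data.Rational.Properties as ℚ
open import Level using (Level; 0ℓ; _⊔_) renaming (suc to lsuc)
open import Relation.Binary.Bundles using (Setoid)
import Relation.Binary.Construct.On as On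
import Relation.Binary.Construct.StrictToNonStrict as StrictToNonStrict
open import Relation.Binary.Core using (Rel)
open import Relation.Binary.PropositionalEquality using (_≡_; _≢_)
open import Relation.Binary.Structures using (IsStrictTotalOrder)
open import Relation.Nullary.Decidable using (yes; no)
open import Relation.Nullary.Negation using (contradiction)
open import Relation.Unary using (Pred; _⊆_; _⊥_)

fib : ℕ → ℕ
fib zero          = 0
fib (suc zero)    = 1
fib (suc (suc n)) = fib (suc n) ℕ.+ fib n

-- The library has no real numbers, so coordinates range over an arbitrary
-- linearly ordered field; classically, ℝ is one.  The inverse is total, with
-- an unspecified value at 0#.
record OrderedField (c ℓ : Level) : Set (lsuc (c ⊔ ℓ)) where
  infix  8 _⁻¹
  infixl 7 _*_
  infixl 6 _+_
  infix  4 _<_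
  field
    Carrier            : Set c
    _<_                : Rel Carrier ℓ
    _+_ _*_            : Op₂ Carrier
    -_ _⁻¹             : Op₁ Carrier
    0# 1#              : Carrier
    isCommutativeRing  : IsCommutativeRing _≡_ _+_ _*_ -_ 0# 1#
    0≢1                : 0# ≢ 1#
    *-inverseʳ         : ∀ x → x ≢ 0# → x * x ⁻¹ ≡ 1#
    isStrictTotalOrder : IsStrictTotalOrder _≡_ _<_
    +-monoʳ-<          : ∀ z {x y} → x < y → z + x < z + y
    *-pos              : ∀ {x y} → 0# < x → 0# < y → 0# < x * y

  commutativeRing : CommutativeRing c c
  commutativeRing = record { isCommutativeRing = isCommutativeRing }

  open StrictToNonStrict _≡_ _<_ public using (_≤_)

  ½ : Carrier
  ½ = (1# + 1#) ⁻¹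

  fromℕ : ℕ → Carrier
  fromℕ n = n · 1#
    where
    open RawMonoidDefs (CommutativeRing.+-rawMonoid commutativeRing)
      using () renaming (_×_ to _·_)

ℚ-orderedField : OrderedField 0ℓ 0ℓ
ℚ-orderedField = record
  { Carrier            = ℚ
  ; _<_                = ℚ._<_
  ; _+_                = ℚ._+_
  ; _*_                = ℚ._*_
  ; -_                 = ℚ.-_
  ; _⁻¹                = inv
  ; 0#                 = 0ℚ
  ; 1#                 = 1ℚ
  ; isCommutativeRing  = ℚ.+-*-isCommutativeRing
  ; 0≢1                = λ ()
  ; *-inverseʳ         = inv-inverseʳ
  ; isStrictTotalOrder = ℚ.<-isStrictTotalOrder
  ; +-monoʳ-<          = λ z x<y → ℚ.+-monoʳ-< z x<y
  ; *-pos              = λ {x} {y} 0<x 0<y →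
      ℚ.positive⁻¹ (x ℚ.* y)
        {{ℚ.pos*pos⇒pos x {{ℚ.positive 0<x}} y {{ℚ.positive 0<y}}}}
  }
  where
  inv : ℚ → ℚ
  inv x with x ℚ.≟ 0ℚ
  ... | yes _  = 0ℚ
  ... | no x≢0 = ℚ.1/_ x {{ℚ.≢-nonZero x≢0}}

  inv-inverseʳ : ∀ x → x ≢ 0ℚ → x ℚ.* inv x ≡ 1ℚ
  inv-inverseʳ x x≢0 with x ℚ.≟ 0ℚ
  ... | yes x≡0 = contradiction x≡0 x≢0
  ... | no x≢0′ = ℚ.*-inverseʳ x {{ℚ.≢-nonZero x≢0′}}

module _ {c ℓ : Level} (K : OrderedField c ℓ) where
  open OrderedField K

  -- All tiles have the height of the board and are not rotated, so a tile is
  -- determined by its shape and the coordinate of its left edge.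
  data Tile : Set c where
    halfSquare : (x : Carrier) → Tile
    fence      : (x : Carrier) → Tile

  -- Left edges of the rectangles of width ½ that make up a tile.
  posts : Tile → List Carrier
  posts (halfSquare x) = x ∷ []
  posts (fence x)      = x ∷ x + 1# ∷ []

  region : Tile → Pred Carrier (c ⊔ ℓ)
  region t p = Any (λ x → x ≤ p × p ≤ x + ½) (posts t)

  -- The two posts of a fence are disjoint, so the interior of the tile is the
  -- union of the interiors of its posts.
  interior : Tile → Pred Carrier (c ⊔ ℓ)
  interior t p = Any (λ x → x < p × p < x + ½) (posts t)

  board : ℕ → Pred Carrier (c ⊔ ℓ)
  board n p = 0# ≤ p × p ≤ fromℕ n

  boardInterior : ℕ → Pred Carrier ℓ
  boardInterior n p = 0# < p × p < fromℕ n

  -- Only interior points are required to be covered, so that the 0-board,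
  -- which degenerates to the single point 0#, has its empty tiling.  For n ≥ 1
  -- the endpoints are then covered too, regions being finite unions of closed
  -- intervals.
  record Tiling (n : ℕ) : Set (c ⊔ ℓ) where
    field
      tiles         : List Tile
      nonProtruding : All (λ t → region t ⊆ board n) tiles
      nonOverlap    : AllPairs (λ s t → interior s ⊥ interior t) tiles
      covering      : boardInterior n ⊆ λ p → Any (λ t → region t p) tiles

  -- A tiling is a finite set of tiles: the order of the list and the proofs are
  -- irrelevant.  Repetitions are excluded by nonOverlap, and finiteness is no
  -- restriction since the tiles have length at least ½.
  tilingSetoid : ℕ → Setoid (c ⊔ ℓ) c
  tilingSetoid n = On.setoid (↭-setoid {A = Tile}) (Tiling.tiles {n})

{-# OPTIONS --safe #-}

-- Cut the board into its 2n half-cells.  Going from left to right, each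
-- half-cell must start a post: the points just to its right are covered, and
-- a post starting earlier would overlap the previous one or leave the board.
-- Hence tiles are aligned with the half-cells.  A half-square fills one
-- half-cell and a fence two half-cells of equal parity that are consecutive
-- among those, so a tiling is a pair of independent square-and-domino tilings
-- of the n even and the n odd half-cells, and each of these has F_{n+1} tilings.
module Submission where

open import Defs
open import Algebra.Bundles using (CommutativeRing)
open import Algebra.Properties.CommutativeSemigroup using (x∙yz≈y∙xz)
import Algebra.Properties.Group as GroupProperties
import Algebra.Properties.Ring as RingProperties
open import Data.Empty using (⊥-elim)
open import Data.Fin.Base using (Fin)
open import Data.Fin.Properties using (+↔⊎; *↔×; 1↔⊤)
open import Data.List.Base using (List; []; _∷_; _++_; concatMap)
open import Data.List.Membership.Propositional using (_∈_; find; lose)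
open import Data.List.Membership.Propositional.Properties
  using (∈-++⁺ˡ; ∈-++⁺ʳ; ∈-++⁻; ∈-concatMap⁺)
open import Data.List.Membership.Propositional.Properties.WithK
  using (unique∧set⇒bag)
open import Data.List.Relation.Binary.BagAndSetEquality using (∼bag⇒↭)
open import Data.List.Relation.Binary.Permutation.Propositional
  using (_↭_; ↭-sym; ↭-trans)
open import Data.List.Relation.Binary.Permutation.Propositional.Properties
  using (∈-resp-↭)
open import Data.List.Relation.Unary.All as All using (All; []; _∷_)
open import Data.List.Relation.Unary.AllPairs as AllPairs
  using (AllPairs; []; _∷_)
import Data.List.Relation.Unary.AllPairs.Properties as AllPairs
open import Data.List.Relation.Unary.Any using (Any; here; there)
open import Data.List.Relation.Unary.Unique.Propositional using (Unique)
open import Data.Nat.Base as ℕ using (ℕ; zero; suc; _^_; parity; z≤n; s≤s)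
import Data.Nat.Properties as ℕ
open import Data.Product.Base using (_×_; _,_; ∃; Σ; proj₁; proj₂)
open import Data.Product.Function.NonDependent.Propositional using (_×-↔_)
open import Data.Sum.Base as Sum using (_⊎_; inj₁; inj₂; [_,_]′)
open import Data.Sum.Function.Propositional using (_⊎-↔_)
open import Data.Unit.Base using (⊤; tt)
open import Function.Base using (_∘_)
open import Function.Bundles using (Inverse; _↔_; mk↔ₛ′; mk⇔)
open import Function.Construct.Composition using (inverse)
open import Function.Properties.Inverse using (↔-sym; ↔-trans)
open import Level using (Level; 0ℓ; _⊔_)
open import Relation.Binary.Core using (Rel)
open import Relation.Binary.Definitions
  using (Symmetric; tri<; tri≈; tri>)
open import Relation.Binary.PropositionalEquality
  using (_≡_; _≢_; refl; sym; trans; cong; subst; subst₂; setoid; module ≡-Reasoning)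
open import Relation.Binary.Structures using (IsStrictTotalOrder)
open import Relation.Nullary.Negation using (¬_; contradiction)
open import Relation.Unary using (Pred; _⊆_; _⊥_)

-- Square-and-domino tilings

infixr 5 square∷_ domino∷_

data Strip : ℕ → Set where
  []       : Strip 0
  square∷_ : ∀ {n} → Strip n → Strip (suc n)
  domino∷_ : ∀ {n} → Strip n → Strip (suc (suc n))

Strip₀↔⊤ : Strip 0 ↔ ⊤
Strip₀↔⊤ = mk↔ₛ′ (λ _ → tt) (λ _ → []) (λ _ → refl) (λ { [] → refl })

Strip₁↔⊤ : Strip 1 ↔ ⊤
Strip₁↔⊤ = mk↔ₛ′ (λ _ → tt) (λ _ → square∷ []) (λ _ → refl)
                 (λ { (square∷ []) → refl })

Strip₂₊↔⊎ : ∀ {n} → Strip (suc (suc n)) ↔ (Strip (suc n) ⊎ Strip n)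
Strip₂₊↔⊎ = mk↔ₛ′
  (λ { (square∷ s) → inj₁ s ; (domino∷ s) → inj₂ s })
  (λ { (inj₁ s) → square∷ s ; (inj₂ s) → domino∷ s })
  (λ { (inj₁ _) → refl ; (inj₂ _) → refl })
  (λ { (square∷ _) → refl ; (domino∷ _) → refl })

-- Sorting strips by their first piece gives the recurrence that defines `fib`, with one strip in
-- each of the two base cases.
Strip↔Fin : ∀ n → Strip n ↔ Fin (fib (suc n))
Strip↔Fin zero          = ↔-trans Strip₀↔⊤ (↔-sym 1↔⊤)
Strip↔Fin (suc zero)    = ↔-trans Strip₁↔⊤ (↔-sym 1↔⊤)
Strip↔Fin (suc (suc n)) =
  ↔-trans Strip₂₊↔⊎ (↔-trans (Strip↔Fin (suc n) ⊎-↔ Strip↔Fin n) (↔-sym +↔⊎))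

Strip²↔Fin : ∀ n → (Strip n × Strip n) ↔ Fin (fib (suc n) ^ 2)
-- The power `_ ^ 2` unfolds to a product ending in `1`; the transport inserts that factor.
Strip²↔Fin n = subst (λ k → (Strip n × Strip n) ↔ Fin (fib (suc n) ℕ.* k))
  (sym (ℕ.*-identityʳ (fib (suc n))))
  (↔-trans (Strip↔Fin n ×-↔ Strip↔Fin n) (↔-sym *↔×))

-- Half-cells of a given parity

-- Row m k c holds when c is one of k, k + 2, …, k + 2(m - 1).
data Row : ℕ → ℕ → ℕ → Set where
  here  : ∀ {m k} → Row (suc m) k k
  there : ∀ {m k c} → Row m (2 ℕ.+ k) c → Row (suc m) k c

Cell : ℕ → ℕ → Set
Cell n c = Row n 0 c ⊎ Row n 1 c

row-lower : ∀ {m k c} → Row m k c → k ℕ.≤ c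
row-lower here      = ℕ.≤-refl
row-lower (there r) = ℕ.≤-trans (ℕ.m≤n+m _ 2) (row-lower r)

-- The last cell is `k + 2(m - 1)`, so the bound is sharp; its extra `suc` absorbs the offset `1` of
-- the odd row in `cell-upper`.
row-upper : ∀ {m k c} → Row m k c → suc c ℕ.< m ℕ.* 2 ℕ.+ k
row-upper {suc m} {k}     here      = s≤s (s≤s (ℕ.m≤n+m k (m ℕ.* 2)))
row-upper {suc m} {k} {c} (there r) = subst (suc c ℕ.<_)
  (x∙yz≈y∙xz ℕ.+-commutativeSemigroup (m ℕ.* 2) 2 k)
  (row-upper r)

row-parity : ∀ {m k c} → Row m k c → parity c ≡ parity k
row-parity here      = refl
row-parity (there r) = row-parity r

-- Serves the induction in `cell`, which lowers the number of a half-cell by two and the length of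
-- its row by one.
row-shift : ∀ {m k c} → Row m k c → Row (suc m) k (2 ℕ.+ c)
row-shift here      = there here
row-shift (there r) = there (row-shift r)

rows-disjoint : ∀ {m m′ i j} → Row m 0 i → Row m′ 1 j → i ≢ j
rows-disjoint r r′ refl with () ← trans (sym (row-parity r)) (row-parity r′)

cell : ∀ n {c} → c ℕ.< n ℕ.* 2 → Cell n c
cell (suc n) {zero}        _             = inj₁ here
cell (suc n) {suc zero}    _             = inj₂ here
cell (suc n) {suc (suc c)} (s≤s (s≤s c<)) = Sum.map row-shift row-shift (cell n c<)

cell-upper : ∀ {n c} → Cell n c → c ℕ.< n ℕ.* 2
cell-upper {n} {c} (inj₁ r) =
  subst (c ℕ.<_) (ℕ.+-identityʳ (n ℕ.* 2)) (ℕ.<-trans (ℕ.n<1+n c) (row-upper r))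
cell-upper {n} {c} (inj₂ r) =
  ℕ.s<s⁻¹ (subst (suc c ℕ.<_) (ℕ.+-comm (n ℕ.* 2) 1) (row-upper r))

-- `AllPairs` relates earlier entries to later ones; symmetry removes the order, and a shared
-- position gives equality.
AllPairs-lookup : ∀ {a r} {A : Set a} {R : Rel A r} → Symmetric R →
  ∀ {xs x y} → AllPairs R xs → x ∈ xs → y ∈ xs → x ≡ y ⊎ R x y
AllPairs-lookup R-sym (_ ∷ _)   (here refl) (here refl) = inj₁ refl
AllPairs-lookup R-sym (rs ∷ _)  (here refl) (there y∈)  = inj₂ (All.lookup rs y∈)
AllPairs-lookup R-sym (rs ∷ _)  (there x∈)  (here refl) = inj₂ (R-sym (All.lookup rs x∈))
AllPairs-lookup R-sym (_ ∷ rss) (there x∈)  (there y∈)  = AllPairs-lookup R-sym rss x∈ y∈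

module _ {c ℓ : Level} (K : OrderedField c ℓ) where
  open OrderedField K
  open IsStrictTotalOrder isStrictTotalOrder
    using (compare; irrefl; asym) renaming (trans to <-trans)

  private
    module R = CommutativeRing commutativeRing
    module G = GroupProperties R.+-group
    module RP = RingProperties R.ring

  -- Ordered fields

  <-≤-trans : ∀ {x y z} → x < y → y ≤ z → x < z
  <-≤-trans x<y (inj₁ y<z)  = <-trans x<y y<z
  <-≤-trans x<y (inj₂ refl) = x<y

  ≤-<-trans : ∀ {x y z} → x ≤ y → y < z → x < z
  ≤-<-trans (inj₁ x<y)  y<z = <-trans x<y y<z
  ≤-<-trans (inj₂ refl) y<z = y<z

  ≤-trans : ∀ {x y z} → x ≤ y → y ≤ z → x ≤ z
  ≤-trans (inj₁ x<y)  y≤z = inj₁ (<-≤-trans x<y y≤z)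
  ≤-trans (inj₂ refl) y≤z = y≤z

  <⇒≱ : ∀ {x y} → x < y → ¬ (y ≤ x)
  <⇒≱ x<y y≤x = irrefl refl (<-≤-trans x<y y≤x)

  ≤-or-> : ∀ x y → x ≤ y ⊎ y < x
  ≤-or-> x y with compare x y
  ... | tri< x<y _ _ = inj₁ (inj₁ x<y)
  ... | tri≈ _ x≡y _ = inj₁ (inj₂ x≡y)
  ... | tri> _ _ y<x = inj₂ y<x

  +-monoˡ-< : ∀ z {x y} → x < y → x + z < y + z
  +-monoˡ-< z x<y = subst₂ _<_ (R.+-comm z _) (R.+-comm z _) (+-monoʳ-< z x<y)

  +-monoˡ-≤ : ∀ z {x y} → x ≤ y → x + z ≤ y + z
  +-monoˡ-≤ z (inj₁ x<y)  = inj₁ (+-monoˡ-< z x<y)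
  +-monoˡ-≤ z (inj₂ refl) = inj₂ refl

  x<x+y : ∀ x {y} → 0# < y → x < x + y
  x<x+y x 0<y = subst (_< x + _) (R.+-identityʳ x) (+-monoʳ-< x 0<y)

  0<1 : 0# < 1#
  0<1 with compare 0# 1#
  ... | tri< 0<1 _ _ = 0<1
  ... | tri≈ _ 0≡1 _ = contradiction 0≡1 0≢1
  -- Here `- 1#` is positive, and its square is `1#`, so the goal follows even in this case.
  ... | tri> _ _ 1<0 = subst (0# <_) -1*-1≡1 (*-pos 0<-1 0<-1)
    where
    0<-1 : 0# < - 1#
    0<-1 = subst₂ _<_ (R.-‿inverseˡ 1#) (R.+-identityʳ (- 1#)) (+-monoʳ-< (- 1#) 1<0)

    -1*-1≡1 : - 1# * - 1# ≡ 1#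
    -1*-1≡1 = trans (RP.-1*x≈-x (- 1#)) (G.⁻¹-involutive 1#)

  ½+½≡1 : ½ + ½ ≡ 1#
  ½+½≡1 = begin
    ½ + ½           ≡⟨ cong (λ x → x + x) (R.*-identityˡ ½) ⟨
    1# * ½ + 1# * ½ ≡⟨ R.distribʳ ½ 1# 1# ⟨
    (1# + 1#) * ½   ≡⟨ *-inverseʳ (1# + 1#) (λ 2≡0 → irrefl (sym 2≡0) (<-trans 0<1 (x<x+y 1# 0<1))) ⟩
    1#              ∎
    where open ≡-Reasoning

  0<½ : 0# < ½
  0<½ with compare 0# ½
  ... | tri< 0<½ _ _ = 0<½
  ... | tri≈ _ 0≡½ _ = contradiction
    (trans (sym (R.+-identityˡ 0#)) (trans (cong (λ x → x + x) 0≡½) ½+½≡1)) 0≢1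
  ... | tri> _ _ ½<0 = contradiction 0<1 (asym (subst (_< 0#) ½+½≡1
    (<-trans (subst (½ + ½ <_) (R.+-identityʳ ½) (+-monoʳ-< ½ ½<0)) ½<0)))

  x<x+½ : ∀ x → x < x + ½
  x<x+½ x = x<x+y x 0<½

  dense : ∀ {x y} → x < y → ∃ λ z → x < z × z < y
  dense {x} {y} x<y = x + d , x<x+y x 0<d , subst (x + d <_) x+[d+d]≡y (+-monoʳ-< x (x<x+y d 0<d))
    where
    d : Carrier
    -- Half the distance, which makes `x + d` the midpoint.
    d = (- x + y) * ½

    0<d : 0# < d
    0<d = *-pos (subst (_< - x + y) (R.-‿inverseˡ x) (+-monoʳ-< (- x) x<y)) 0<½

    x+[d+d]≡y : x + (d + d) ≡ y
    x+[d+d]≡y = begin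
      x + (d + d)               ≡⟨ cong (x +_) (R.distribˡ (- x + y) ½ ½) ⟨
      x + (- x + y) * (½ + ½)   ≡⟨ cong (λ z → x + (- x + y) * z) ½+½≡1 ⟩
      x + (- x + y) * 1#        ≡⟨ cong (x +_) (R.*-identityʳ (- x + y)) ⟩
      x + (- x + y)             ≡⟨ G.\\-leftDividesˡ x y ⟩
      y                         ∎
      where open ≡-Reasoning

  -- Finds a point just to the right of `u`. Each entry of the finite list that lies in the current
  -- interval above `u` becomes its new upper end.
  point-below-later : ∀ xs {u v} → u < v →
    ∃ λ p → u < p × p < v × (∀ {x} → x ∈ xs → x ≤ p → x ≤ u)
  point-below-later []       u<v with p , u<p , p<v ← dense u<v = p , u<p , p<v , λ ()
  point-below-later (x ∷ xs) {u} {v} u<v with ≤-or-> x u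
  ... | inj₁ x≤u with p , u<p , p<v , q ← point-below-later xs u<v =
    p , u<p , p<v , λ { (here refl) _ → x≤u ; (there y∈) → q y∈ }
  ... | inj₂ u<x with ≤-or-> x v
  ...   | inj₁ x≤v with p , u<p , p<x , q ← point-below-later xs u<x =
    p , u<p , <-≤-trans p<x x≤v ,
    λ { (here refl) x≤p → contradiction x≤p (<⇒≱ p<x) ; (there y∈) → q y∈ }
  ...   | inj₂ v<x with p , u<p , p<v , q ← point-below-later xs u<v =
    p , u<p , p<v ,
    λ { (here refl) x≤p → contradiction x≤p (<⇒≱ (<-trans p<v v<x)) ; (there y∈) → q y∈ }

  -- Multiples of ½

  half : ℕ → Carrier
  half zero    = 0#
  half (suc k) = half k + ½

  half+1 : ∀ k → half k + 1# ≡ half (2 ℕ.+ k)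
  half+1 k = trans (cong (half k +_) (sym ½+½≡1)) (sym (R.+-assoc (half k) ½ ½))

  half-fromℕ : ∀ n → half (n ℕ.* 2) ≡ fromℕ n
  half-fromℕ zero    = refl
  half-fromℕ (suc n) = begin
    half (2 ℕ.+ n ℕ.* 2) ≡⟨ half+1 (n ℕ.* 2) ⟨
    half (n ℕ.* 2) + 1#  ≡⟨ cong (_+ 1#) (half-fromℕ n) ⟩
    fromℕ n + 1#         ≡⟨ R.+-comm (fromℕ n) 1# ⟩
    1# + fromℕ n         ∎
    where open ≡-Reasoning

  half-mono-≤′ : ∀ {i j} → i ℕ.≤′ j → half i ≤ half j
  half-mono-≤′ (ℕ.≤′-reflexive refl) = inj₂ refl
  half-mono-≤′ (ℕ.≤′-step i≤j)       = ≤-trans (half-mono-≤′ i≤j) (inj₁ (x<x+½ _))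

  half-mono-≤ : ∀ {i j} → i ℕ.≤ j → half i ≤ half j
  half-mono-≤ = half-mono-≤′ ∘ ℕ.≤⇒≤′

  -- The field may be non-Archimedean; the given bound `half N` lets a descent from `N` find the
  -- half-cell of `x`.
  floor : ∀ N {x} → 0# ≤ x → x < half N →
    ∃ λ k → k ℕ.< N × half k ≤ x × x < half (suc k)
  floor zero    0≤x x<0 = contradiction 0≤x (<⇒≱ x<0)
  floor (suc N) {x} 0≤x x<  with ≤-or-> (half N) x
  ... | inj₁ N≤x = N , ℕ.n<1+n N , N≤x , x<
  ... | inj₂ x<N with k , k<N , k≤x , x<k+1 ← floor N 0≤x x<N =
    k , ℕ.m<n⇒m<1+n k<N , k≤x , x<k+1

  -- From strips to tilings

  NonOverlap : Rel (Tile K) (c ⊔ ℓ)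
  NonOverlap s t = interior K s ⊥ interior K t

  nonOverlap-sym : Symmetric NonOverlap
  nonOverlap-sym no (p∈t , p∈s) = no (p∈s , p∈t)

  Apart : Rel Carrier (c ⊔ ℓ)
  Apart x y = x + ½ ≤ y ⊎ y + ½ ≤ x

  half-apart : ∀ {i j} → i ≢ j → Apart (half i) (half j)
  half-apart {i} {j} i≢j with ℕ.<-cmp i j
  ... | tri< i<j _ _ = inj₁ (half-mono-≤ i<j)
  ... | tri≈ _ i≡j _ = contradiction i≡j i≢j
  ... | tri> _ _ j<i = inj₂ (half-mono-≤ j<i)

  apart⇒nonOverlap : ∀ {s t} →
    (∀ {x y} → x ∈ posts K s → y ∈ posts K t → Apart x y) → NonOverlap s t
  apart⇒nonOverlap apart (p∈s , p∈t)
    with x , x∈ , x<p , p<x+½ ← find p∈s | y , y∈ , y<p , p<y+½ ← find p∈t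
    with apart x∈ y∈
  ... | inj₁ x+½≤y = <⇒≱ (<-trans y<p p<x+½) x+½≤y
  ... | inj₂ y+½≤x = <⇒≱ (<-trans x<p p<y+½) y+½≤x

  -- With `P` as the set of half-cells open to a tile, non-overlap of tiles reduces to disjointness
  -- of sets of numbers.
  AlignedIn : Pred ℕ 0ℓ → Tile K → Set c
  AlignedIn P t = ∀ {x} → x ∈ posts K t → ∃ λ i → P i × x ≡ half i

  aligned⇒nonOverlap : ∀ {P Q s t} → AlignedIn P s → AlignedIn Q t →
    (∀ {i j} → P i → Q j → i ≢ j) → NonOverlap s t
  aligned⇒nonOverlap {s = s} {t} s-al t-al i≢j = apart⇒nonOverlap {s} {t} apart
    where
    apart : ∀ {x y} → x ∈ posts K s → y ∈ posts K t → Apart x y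
    apart x∈ y∈ with i , Pi , refl ← s-al x∈ | j , Qj , refl ← t-al y∈ = half-apart (i≢j Pi Qj)

  -- Here `k` is the first half-cell still free in its row. Neighbours in a row are two half-cells
  -- apart, so the posts of a fence at `half k` fill the half-cells `k` and `2 + k`.
  layout : ∀ {m} → ℕ → Strip m → List (Tile K)
  layout k []          = []
  layout k (square∷ s) = halfSquare (half k) ∷ layout (2 ℕ.+ k) s
  layout k (domino∷ s) = fence (half k) ∷ layout (4 ℕ.+ k) s

  -- The bound is the first half-cell of the rest of the row, to be compared with `row-lower`;
  -- likewise `4 + k` for a fence.
  square-aligned : ∀ k → AlignedIn (ℕ._< 2 ℕ.+ k) (halfSquare (half k))
  square-aligned k (here refl) = k , ℕ.m<n⇒m<1+n (ℕ.n<1+n k) , refl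

  fence-aligned : ∀ k → AlignedIn (ℕ._< 4 ℕ.+ k) (fence (half k))
  fence-aligned k (here refl)         = k , ℕ.m≤n+m (suc k) 3 , refl
  fence-aligned k (there (here refl)) = 2 ℕ.+ k , ℕ.m≤n+m (3 ℕ.+ k) 1 , half+1 k

  layout-aligned : ∀ {m} k (s : Strip m) {t} → t ∈ layout k s → AlignedIn (Row m k) t
  layout-aligned k (square∷ s) (here refl) (here refl)         = k , here , refl
  layout-aligned k (square∷ s) (there t∈)  x∈
    with i , r , eq ← layout-aligned (2 ℕ.+ k) s t∈ x∈         = i , there r , eq
  layout-aligned k (domino∷ s) (here refl) (here refl)         = k , here , refl
  layout-aligned k (domino∷ s) (here refl) (there (here refl)) = 2 ℕ.+ k , there here , half+1 k
  layout-aligned k (domino∷ s) (there t∈)  x∈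
    with i , r , eq ← layout-aligned (4 ℕ.+ k) s t∈ x∈         = i , there (there r) , eq

  layout-covers : ∀ {m k i} (s : Strip m) → Row m k i →
    ∃ λ t → t ∈ layout k s × half i ∈ posts K t
  layout-covers (square∷ s) here      = _ , here refl , here refl
  layout-covers (square∷ s) (there r)
    with t , t∈ , i∈ ← layout-covers s r = t , there t∈ , i∈
  layout-covers (domino∷ s) here      = _ , here refl , here refl
  layout-covers {k = k} (domino∷ s) (there here) = _ , here refl , there (here (sym (half+1 k)))
  layout-covers (domino∷ s) (there (there r))
    with t , t∈ , i∈ ← layout-covers s r = t , there t∈ , i∈

  layout-nonOverlap : ∀ {m} k (s : Strip m) → AllPairs NonOverlap (layout k s)
  layout-nonOverlap k []          = []
  layout-nonOverlap k (square∷ s) =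
    All.tabulate (λ {t} t∈ → aligned⇒nonOverlap {s = halfSquare (half k)} {t}
      (square-aligned k) (layout-aligned _ s t∈)
      (λ i< r → ℕ.<⇒≢ (ℕ.<-≤-trans i< (row-lower r))))
    ∷ layout-nonOverlap (2 ℕ.+ k) s
  layout-nonOverlap k (domino∷ s) =
    All.tabulate (λ {t} t∈ → aligned⇒nonOverlap {s = fence (half k)} {t}
      (fence-aligned k) (layout-aligned _ s t∈)
      (λ i< r → ℕ.<⇒≢ (ℕ.<-≤-trans i< (row-lower r))))
    ∷ layout-nonOverlap (4 ℕ.+ k) s

  layout₂ : ∀ {n} → Strip n × Strip n → List (Tile K)
  layout₂ (a , b) = layout 0 a ++ layout 1 b

  layout₂-aligned : ∀ {n} (ab : Strip n × Strip n) {t} → t ∈ layout₂ ab → AlignedIn (Cell n) t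
  layout₂-aligned (a , b) t∈ x∈ with ∈-++⁻ (layout 0 a) t∈
  ... | inj₁ t∈a with i , r , eq ← layout-aligned 0 a t∈a x∈ = i , inj₁ r , eq
  ... | inj₂ t∈b with i , r , eq ← layout-aligned 1 b t∈b x∈ = i , inj₂ r , eq

  layout₂-covers : ∀ {n i} (ab : Strip n × Strip n) → Cell n i →
    ∃ λ t → t ∈ layout₂ ab × half i ∈ posts K t
  layout₂-covers (a , b) (inj₁ r) with t , t∈ , i∈ ← layout-covers a r = t , ∈-++⁺ˡ t∈ , i∈
  layout₂-covers (a , b) (inj₂ r) with t , t∈ , i∈ ← layout-covers b r =
    t , ∈-++⁺ʳ (layout 0 a) t∈ , i∈

  realise : ∀ {n} → Strip n × Strip n → Tiling K n
  realise {n} ab@(a , b) = record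
    { tiles         = layout₂ ab
    ; nonProtruding = All.tabulate (λ {t} t∈ → region⊆board {t} t∈)
    ; nonOverlap    = AllPairs.++⁺ (layout-nonOverlap 0 a) (layout-nonOverlap 1 b)
        (All.tabulate λ {s} s∈ → All.tabulate λ {t} t∈ → aligned⇒nonOverlap {s = s} {t}
          (layout-aligned 0 a s∈) (layout-aligned 1 b t∈) rows-disjoint)
    ; covering      = covered
    }
    where
    region⊆board : ∀ {t} → t ∈ layout₂ ab → region K t ⊆ board K n
    region⊆board t∈ p∈t
      with x , x∈ , x≤p , p≤x+½ ← find p∈t
      with i , i∈ , refl ← layout₂-aligned ab t∈ x∈ =
      ≤-trans (half-mono-≤ {0} {i} z≤n) x≤p ,
      ≤-trans p≤x+½ (subst (half (suc i) ≤_) (half-fromℕ n) (half-mono-≤ (cell-upper i∈)))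

    covered : boardInterior K n ⊆ λ p → Any (λ t → region K t p) (layout₂ ab)
    covered {p} (0<p , p<n)
      with i , i< , i≤p , p<i+1 ← floor (n ℕ.* 2) (inj₁ 0<p) (subst (p <_) (sym (half-fromℕ n)) p<n)
      with t , t∈ , i∈ ← layout₂-covers ab (cell n i<) =
      lose t∈ (lose i∈ (i≤p , inj₁ p<i+1))

  -- From tilings to strips

  post-interior : ∀ {t x p} → x ∈ posts K t → x < p → p < x + ½ → interior K t p
  post-interior x∈ x<p p<x+½ = lose x∈ (x<p , p<x+½)

  leftEdge : ∀ t → ∃ λ x → x ∈ posts K t
  leftEdge (halfSquare x) = x , here refl
  leftEdge (fence x)      = x , here refl

  ½<1 : ½ < 1#
  ½<1 = subst (½ <_) ½+½≡1 (x<x+½ ½)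

  posts-apart : ∀ {t x y} → x ∈ posts K t → y ∈ posts K t → x < y → x + ½ ≤ y
  posts-apart {halfSquare _} (here refl)         (here refl)         x<x = contradiction x<x (irrefl refl)
  posts-apart {fence _}      (here refl)         (here refl)         x<x = contradiction x<x (irrefl refl)
  posts-apart {fence x}      (here refl)         (there (here refl)) _   = inj₁ (+-monoʳ-< x ½<1)
  posts-apart {fence x}      (there (here refl)) (here refl)         x+1<x =
    contradiction (x<x+y x 0<1) (asym x+1<x)
  posts-apart {fence _}      (there (here refl)) (there (here refl)) x<x = contradiction x<x (irrefl refl)

  -- A tile has interior points and therefore overlaps itself; this rules out repetitions in a
  -- tiling.
  nonOverlap⇒≢ : ∀ {s t} → NonOverlap s t → s ≢ t
  nonOverlap⇒≢ {s} no refl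
    with x , x∈ ← leftEdge s
    with p , x<p , p<x+½ ← dense (x<x+½ x) =
    no (post-interior {s} x∈ x<p p<x+½ , post-interior {s} x∈ x<p p<x+½)

  module _ {n : ℕ} (T : Tiling K n) where
    open Tiling T

    tiles-unique : Unique tiles
    tiles-unique = AllPairs.map (λ {s} {t} → nonOverlap⇒≢ {s} {t}) nonOverlap

    post-lower : ∀ {t x} → t ∈ tiles → x ∈ posts K t → 0# ≤ x
    post-lower t∈ x∈ =
      proj₁ (All.lookup nonProtruding t∈ (lose x∈ (inj₂ refl , inj₁ (x<x+½ _))))

    post-upper : ∀ {t x} → t ∈ tiles → x ∈ posts K t → x + ½ ≤ half (n ℕ.* 2)
    post-upper t∈ x∈ = subst (_ ≤_) (sym (half-fromℕ n))
      (proj₂ (All.lookup nonProtruding t∈ (lose x∈ (inj₁ (x<x+½ _) , inj₂ refl))))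

    -- A point strictly between `y` and `x + ½` is interior to both tiles, which distinct entries of
    -- a tiling cannot share.
    overlap⇒≡ : ∀ {s t x y} → s ∈ tiles → t ∈ tiles → x ∈ posts K s → y ∈ posts K t →
      x ≤ y → y < x + ½ → s ≡ t
    overlap⇒≡ {s} {t} s∈ t∈ x∈ y∈ x≤y y<x+½
      with AllPairs-lookup (λ {s} {t} → nonOverlap-sym {s} {t}) nonOverlap s∈ t∈
    ... | inj₁ s≡t = s≡t
    ... | inj₂ no with p , y<p , p<x+½ ← dense y<x+½ = ⊥-elim (no
      ( post-interior {s} x∈ (≤-<-trans x≤y y<p) p<x+½
      , post-interior {t} y∈ y<p (<-≤-trans p<x+½ (+-monoˡ-≤ ½ x≤y))))

    Occupied : ℕ → Set c
    Occupied i = ∃ λ t → t ∈ tiles × half i ∈ posts K t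

    -- Such a post would overlap the one at `half i`, hence belong to the same tile, whose posts do
    -- not overlap.
    no-post-between : ∀ {i t x} → Occupied i → t ∈ tiles → x ∈ posts K t →
      half i < x → ¬ (x < half (suc i))
    no-post-between (s , s∈ , i∈) t∈ x∈ i<x x<i+1
      with refl ← overlap⇒≡ s∈ t∈ i∈ x∈ (inj₁ i<x) x<i+1 =
      <⇒≱ x<i+1 (posts-apart {s} i∈ x∈ i<x)

    -- At `0` the post would protrude from the board. Otherwise it would either end too early to
    -- pass `half i` or start strictly inside the preceding half-cell, which is occupied. The
    -- premise on predecessors is vacuous at `0`.
    no-post-before : ∀ {i t x} → (∀ {j} → i ≡ suc j → Occupied j) →
      t ∈ tiles → x ∈ posts K t → half i < x + ½ → ¬ (x < half i)
    no-post-before {zero}  _    t∈ x∈ _      x<0   = <⇒≱ x<0 (post-lower t∈ x∈)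
    no-post-before {suc i} prev t∈ x∈ i<x+½ x<i+1 with ≤-or-> _ (half i)
    ... | inj₁ x≤i = <⇒≱ i<x+½ (+-monoˡ-≤ ½ x≤i)
    ... | inj₂ i<x = no-post-between {i} (prev refl) t∈ x∈ i<x x<i+1

    occupied-next : ∀ {i} → (∀ {j} → i ≡ suc j → Occupied j) → i ℕ.< n ℕ.* 2 → Occupied i
    occupied-next {i} prev i<
      -- The list holds the left edges of all posts, so a post that covers `p` starts at `half i` or
      -- earlier; `no-post-before` then leaves only `half i`.
      with p , i<p , p<i+1 , no-later ← point-below-later (concatMap (posts K) tiles) (x<x+½ (half i))
      with t , t∈ , p∈t ← find (covering (≤-<-trans (half-mono-≤ {0} {i} z≤n) i<p ,
             subst (p <_) (half-fromℕ n) (<-≤-trans p<i+1 (half-mono-≤ i<))))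
      with x , x∈ , x≤p , p≤x+½ ← find p∈t
      with no-later (∈-concatMap⁺ (posts K) (lose t∈ x∈)) x≤p
    ... | inj₂ refl = t , t∈ , x∈
    ... | inj₁ x<i  = contradiction x<i (no-post-before prev t∈ x∈ (<-≤-trans i<p p≤x+½))

    occupied : ∀ {i} → i ℕ.< n ℕ.* 2 → Occupied i
    occupied {zero}  i< = occupied-next (λ ()) i<
    occupied {suc i} i< = occupied-next (λ { refl → occupied (ℕ.<-trans (ℕ.n<1+n i) i<) }) i<

    -- Reading the two strips off a tiling

    Placed : ∀ {m} → ℕ → Strip m → Set c
    Placed k s = All (_∈ tiles) (layout k s)

    square-fence-clash : ∀ {x} → halfSquare x ∈ tiles → ¬ (fence x ∈ tiles)
    square-fence-clash sq∈ fe∈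
      with () ← overlap⇒≡ sq∈ fe∈ (here refl) (here refl) (inj₂ refl) (x<x+½ _)

    -- The right post of the first fence would coincide with the left post of the second, making the
    -- two fences equal.
    fence-fence-clash : ∀ {x} → fence x ∈ tiles → ¬ (fence (x + 1#) ∈ tiles)
    fence-fence-clash {x} fe∈ fe′∈ = irrefl (fence-injective
      (overlap⇒≡ fe∈ fe′∈ (there (here refl)) (here refl) (inj₂ refl) (x<x+½ _))) (x<x+y x 0<1)
      where
      fence-injective : ∀ {x y} → fence {K = K} x ≡ fence y → x ≡ y
      fence-injective refl = refl

    -- The hypothesis on fences says that no fence placed further left has its
    -- right post at half k.
    row-strip : ∀ m k → n ℕ.* 2 ℕ.≤ m ℕ.* 2 ℕ.+ k → (∀ {i} → Row m k i → Occupied i) →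
      (∀ {x} → x + 1# ≡ half k → ¬ (fence x ∈ tiles)) → Σ (Strip m) (Placed k)
    row-strip zero    k bound occ clear = [] , []
    row-strip (suc m) k bound occ clear with occ here
    ... | fence x , t∈ , there (here eq) = contradiction t∈ (clear (sym eq))
    ... | halfSquare _ , t∈ , here refl
      with s , placed ← row-strip m (2 ℕ.+ k)
             (subst (n ℕ.* 2 ℕ.≤_) (sym (x∙yz≈y∙xz ℕ.+-commutativeSemigroup (m ℕ.* 2) 2 k)) bound)
             (occ ∘ there)
             -- A fence with its right post at `half (2 + k)` would start at `half k`, where the
             -- half-square is.
             (λ eq fe∈ → square-fence-clash t∈
               (subst (λ x → fence x ∈ tiles) (G.∙-cancelʳ 1# _ _ (trans eq (sym (half+1 k)))) fe∈))
      = square∷ s , t∈ ∷ placed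
    -- Only one half-cell of the row remains: the right post would start at `half (2 + k)`, which by
    -- `bound` is no earlier than the end of the board.
    row-strip (suc zero) k bound occ clear | fence _ , t∈ , here refl =
      contradiction (post-upper t∈ (there (here refl)))
        (<⇒≱ (≤-<-trans (half-mono-≤ bound)
          (subst (λ x → half (2 ℕ.+ k) < x + ½) (sym (half+1 k)) (x<x+½ _))))
    row-strip (suc (suc m)) k bound occ clear | fence _ , t∈ , here refl
      with s , placed ← row-strip m (4 ℕ.+ k)
             (subst (n ℕ.* 2 ℕ.≤_) (sym (x∙yz≈y∙xz ℕ.+-commutativeSemigroup (m ℕ.* 2) 4 k)) bound)
             (λ r → occ (there (there r)))
             -- A fence with its right post at `half (4 + k)` would start where the current fence
             -- has its right post.
             (λ eq fe∈ → fence-fence-clash t∈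
               (subst (λ x → fence x ∈ tiles)
                 (trans (G.∙-cancelʳ 1# _ _ (trans eq (sym (half+1 (2 ℕ.+ k))))) (sym (half+1 k))) fe∈))
      = domino∷ s , t∈ ∷ placed

    -- From left to right, the tile starting at `half k` decides between square and domino.
    strip-unique : ∀ {m} k (s s′ : Strip m) → Placed k s → Placed k s′ → s ≡ s′
    strip-unique k []          []           _          _          = refl
    strip-unique k (square∷ s) (square∷ s′) (_ ∷ ps)   (_ ∷ ps′)  = cong square∷_ (strip-unique _ s s′ ps ps′)
    strip-unique k (domino∷ s) (domino∷ s′) (_ ∷ ps)   (_ ∷ ps′)  = cong domino∷_ (strip-unique _ s s′ ps ps′)
    strip-unique k (square∷ s) (domino∷ s′) (sq∈ ∷ _)  (fe∈ ∷ _)  = contradiction fe∈ (square-fence-clash sq∈)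
    strip-unique k (domino∷ s) (square∷ s′) (fe∈ ∷ _)  (sq∈ ∷ _)  = contradiction fe∈ (square-fence-clash sq∈)

    -- Starts both rows: a right post at `0#` or `½` would put the left post outside the board.
    fences-nonneg : ∀ {x} → x + 1# < 1# → ¬ (fence x ∈ tiles)
    fences-nonneg {x} x+1<1 fe∈ = <⇒≱ x+1<1
      (subst (_≤ x + 1#) (R.+-identityˡ 1#) (+-monoˡ-≤ 1# (post-lower fe∈ (here refl))))

    even-strip : Σ (Strip n) (Placed 0)
    even-strip = row-strip n 0 (ℕ.m≤m+n _ 0) (occupied ∘ cell-upper ∘ inj₁)
      (λ eq → fences-nonneg (subst (_< 1#) (sym eq) 0<1))

    odd-strip : Σ (Strip n) (Placed 1)
    odd-strip = row-strip n 1 (ℕ.m≤m+n _ 1) (occupied ∘ cell-upper ∘ inj₂)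
      (λ eq → fences-nonneg (subst (_< 1#) (sym (trans eq (R.+-identityˡ ½))) ½<1))

    strips : Strip n × Strip n
    strips = proj₁ even-strip , proj₁ odd-strip

    strips-placed : ∀ {t} → t ∈ layout₂ strips → t ∈ tiles
    strips-placed t∈ = [ All.lookup (proj₂ even-strip) , All.lookup (proj₂ odd-strip) ]′
      (∈-++⁻ (layout 0 (proj₁ even-strip)) t∈)

    strips-unique : ∀ ab → (∀ {t} → t ∈ layout₂ ab → t ∈ tiles) → strips ≡ ab
    strips-unique (a , b) placed
      with refl ← strip-unique 0 _ a (proj₂ even-strip) (All.tabulate (placed ∘ ∈-++⁺ˡ))
         | refl ← strip-unique 1 _ b (proj₂ odd-strip) (All.tabulate (placed ∘ ∈-++⁺ʳ (layout 0 a)))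
      = refl

    -- The left edge of any tile lies in a half-cell already filled by a post of the layout, so the
    -- two tiles overlap and are equal.
    layout₂-exhausts : ∀ ab → (∀ {t} → t ∈ layout₂ ab → t ∈ tiles) →
      ∀ {t} → t ∈ tiles → t ∈ layout₂ ab
    layout₂-exhausts ab placed {t} t∈
      with x , x∈ ← leftEdge t
      with i , i< , i≤x , x<i+1 ← floor (n ℕ.* 2) (post-lower t∈ x∈)
             (<-≤-trans (x<x+½ x) (post-upper t∈ x∈))
      with s , s∈ , i∈ ← layout₂-covers ab (cell n i<)
      with refl ← overlap⇒≡ (placed s∈) t∈ i∈ x∈ i≤x x<i+1 = s∈

  -- The bijection between tilings and pairs of strips

  layout₂-strips-↭ : ∀ {n} (T : Tiling K n) → layout₂ (strips T) ↭ Tiling.tiles T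
  -- Two lists without repetitions and with the same members are permutations of each other.
  layout₂-strips-↭ T = ∼bag⇒↭ (unique∧set⇒bag
    (tiles-unique (realise (strips T))) (tiles-unique T)
    (mk⇔ (strips-placed T) (layout₂-exhausts T (strips T) (strips-placed T))))

  -- Yields both the congruence of `strips` and one inverse law, since a pair of strips is
  -- determined by which tiles are members of the tiling.
  strips-resp-↭ : ∀ {n} (T : Tiling K n) ab → Tiling.tiles T ↭ layout₂ ab → strips T ≡ ab
  strips-resp-↭ T ab T↭ab = strips-unique T ab (∈-resp-↭ (↭-sym T↭ab))

  tilings↔strips : ∀ n → Inverse (tilingSetoid K n) (setoid (Strip n × Strip n))
  tilings↔strips n = record
    { to        = strips
    ; from      = realise
    ; to-cong   = λ {T} {T′} T↭T′ →
        strips-resp-↭ T (strips T′) (↭-trans T↭T′ (↭-sym (layout₂-strips-↭ T′)))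
    ; from-cong = λ { refl → _↭_.refl }
    ; inverse   = (λ {ab} {T} T↭ab → strips-resp-↭ T ab T↭ab)
                , (λ { {T} refl → layout₂-strips-↭ T })
    }

theorem3p2 : ∀ {c ℓ : Level} (K : OrderedField c ℓ) (n : ℕ) →
    Inverse (tilingSetoid K n) (setoid (Fin (fib (suc n) ^ 2)))
theorem3p2 K n = inverse (tilings↔strips K n) (Strip²↔Fin n)
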